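{- Let $R:\{0,1\}^n\times\{0,1\}^m\to[0,1]$ be a randomized $q$-query algorithm and consider its mean function $\mu_R(x):=\mathbb{E}_{r}[R(x,r)]$, where $r\sim\{0,1\}^m$ is uniform. There is a variable $i\in[n]$ such that $$\mathrm{Inf}_i(\mu_R):=\mathop{\mathbb{E}}_{x}\big[|\mu_R(x)-\mu_R(x^{\oplus i})|\big]\ \ge\ \frac{\mathrm{Var}(\mu_R)}{q},$$ where $x\sim\{0,1\}^n$ is uniform, $\mathrm{Var}(\mu_R)$ is the variance of $\mu_R(x)$, and $x^{\oplus i}$ denotes $x$ with its $i$-th coordinate flipped.
   Context: Query algorithms are represented as binary decision trees. An $n$-variable randomized decision tree is a binary tree with two types of internal nodes: decision nodes, which branch on the value of one of the boolean variables $x_1,\dots,x_n$, and stochastic nodes, which branch on the outcome of an independent $\mathrm{Bernoulli}(\frac12)$ random bit. Leaves are labelled by values in $[0,1]$. Its query complexity is the maximum number of decision nodes on any root-to-leaf path, and its randomness complexity is the maximum number $m$ of stochastic nodes on any root-to-leaf path. $R(x,r)$ is the label of the leaf reached on input $x$ when the stochastic nodes encountered branch according to the bits of $r\in\{0,1\}^m$. A randomized $q$-query algorithm is such a tree of query complexity at most $q$; here $n,q\ge1$. -}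

module Defs where

open import Algebra.Bundles using (CommutativeRing; Semiring)
import Algebra.Definitions.RawSemiring as RawSemiringDefinitions
open import Data.Bool.Base using (Bool; true; false; not; if_then_else_)
open import Data.Fin.Base using (Fin)
open import Data.Nat.Base as ℕ using (ℕ; zero; suc)
open import Data.Nat.Properties using (m≤m⊔n; m≤n⊔m)
open import Data.Sum.Base using ([_,_]′)
open import Data.Vec.Base using (Vec; []; _∷_; lookup; updateAt; truncate)
open import Function.Base using (const)
open import Level using (Level; _⊔_) renaming (suc to lsuc)
open import Relation.Binary.Core using (Rel)
open import Relation.Binary.Structures using (IsTotalOrder)

-- Totally ordered fields: the real numbers are (classically) an instance.
-- The inverse is a total operation, unconstrained at 0#.
record OrderedField (c ℓ₁ ℓ₂ : Level) : Set (lsuc (c ⊔ ℓ₁ ⊔ ℓ₂)) where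
  infix  9 _⁻¹
  infixl 7 _/_
  infix  4 _≤_
  field
    commutativeRing : CommutativeRing c ℓ₁

  open CommutativeRing commutativeRing public

  field
    _≤_          : Rel Carrier ℓ₂
    _⁻¹          : Carrier → Carrier
    isTotalOrder : IsTotalOrder _≈_ _≤_
    +-monoˡ-≤    : ∀ {x y} z → x ≤ y → x + z ≤ y + z
    *-nonNeg     : ∀ {x y} → 0# ≤ x → 0# ≤ y → 0# ≤ x * y
    1≉0          : 1# ≉ 0#
    ⁻¹-cong      : ∀ {x y} → x ≈ y → x ⁻¹ ≈ y ⁻¹
    ⁻¹-inverseʳ  : ∀ {x} → x ≉ 0# → x * x ⁻¹ ≈ 1#

  open IsTotalOrder isTotalOrder public
    using (total; antisym; ≤-respˡ-≈; ≤-respʳ-≈; isPartialOrder)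
    renaming (reflexive to ≤-reflexive; refl to ≤-refl; trans to ≤-trans)

  open RawSemiringDefinitions (Semiring.rawSemiring semiring) public
    using (_×_; _^_)

  _/_ : Carrier → Carrier → Carrier
  x / y = x * y ⁻¹

  fromℕ : ℕ → Carrier
  fromℕ k = k × 1#

  ∣_∣ : Carrier → Carrier
  ∣ x ∣ = [ const x , const (- x) ]′ (total 0# x)

module DecisionTree {c ℓ₁ ℓ₂} (F : OrderedField c ℓ₁ ℓ₂) where
  open OrderedField F

  record UnitInterval : Set (c ⊔ ℓ₂) where
    constructor mkUnit
    field
      value : Carrier
      0≤    : 0# ≤ value
      ≤1    : value ≤ 1#

  open UnitInterval public using (value)

  data Tree (n : ℕ) : Set (c ⊔ ℓ₂) where
    leaf     : UnitInterval → Tree n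
    decision : Fin n → Tree n → Tree n → Tree n
    coin     : Tree n → Tree n → Tree n

  queryComplexity : ∀ {n} → Tree n → ℕ
  queryComplexity (leaf _)           = 0
  queryComplexity (decision _ t₀ t₁) = suc (queryComplexity t₀ ℕ.⊔ queryComplexity t₁)
  queryComplexity (coin t₀ t₁)       = queryComplexity t₀ ℕ.⊔ queryComplexity t₁

  randomness : ∀ {n} → Tree n → ℕ
  randomness (leaf _)           = 0
  randomness (decision _ t₀ t₁) = randomness t₀ ℕ.⊔ randomness t₁
  randomness (coin t₀ t₁)       = suc (randomness t₀ ℕ.⊔ randomness t₁)

  -- The k-th stochastic node met on the path branches on the k-th bit of r.
  -- A subtree that needs fewer bits than its sibling ignores the last ones.
  run : ∀ {n} (R : Tree n) → Vec Bool n → Vec Bool (randomness R) → UnitInterval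
  run (leaf v)           x r = v
  run (decision i t₀ t₁) x r =
    if lookup x i
      then run t₁ x (truncate (m≤n⊔m (randomness t₀) (randomness t₁)) r)
      else run t₀ x (truncate (m≤m⊔n (randomness t₀) (randomness t₁)) r)
  run (coin t₀ t₁)       x (b ∷ r) =
    if b
      then run t₁ x (truncate (m≤n⊔m (randomness t₀) (randomness t₁)) r)
      else run t₀ x (truncate (m≤m⊔n (randomness t₀) (randomness t₁)) r)

  ∑ : ∀ {k} → (Vec Bool k → Carrier) → Carrier
  ∑ {zero}  f = f []
  ∑ {suc k} f = ∑ (λ x → f (false ∷ x)) + ∑ (λ x → f (true ∷ x))

  𝔼 : ∀ {k} → (Vec Bool k → Carrier) → Carrier
  𝔼 {k} f = ∑ f / fromℕ (2 ℕ.^ k)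

  Var : ∀ {k} → (Vec Bool k → Carrier) → Carrier
  Var f = 𝔼 (λ x → (f x - 𝔼 f) ^ 2)

  flip : ∀ {k} → Fin k → Vec Bool k → Vec Bool k
  flip i x = updateAt x i not

  Inf : ∀ {k} → Fin k → (Vec Bool k → Carrier) → Carrier
  Inf i f = 𝔼 (λ x → ∣ f x - f (flip i x) ∣)

  mean : ∀ {n} → Tree n → Vec Bool n → Carrier
  mean R x = 𝔼 (λ r → value (run R x r))

{-# OPTIONS --safe #-}
module Submission where

-- Write L g for the sum over x of (f x - 𝔼 f) * g x, where f = mean R; it is
-- the covariance of f and g up to the factor 2 ^ n, and L f is the variance of
-- f up to the same factor.  Let M be the largest of the unnormalised
-- influences, the sums over x of ∣ f x - f (flip i x) ∣.  The theorem follows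
-- from the case T = R, d = q of the bound L (mean T) ≤ d × M, which holds for
-- all trees T that make at most d queries.  This is a form of the
-- O'Donnell-Saks-Schramm-Servedio inequality.
--
-- The bound is proved by induction on T (`covariance-bound`).  At a leaf,
-- L vanishes on constants.  At a coin node, mean T is the average of the means
-- of the two subtrees, and L is linear.  At a node that queries the variable i,
-- let g be the mean of the tree, and let g₀ and g₁ be the means of its two
-- subtrees, with the i-th input fixed to 0 and to 1.  At each x, the two values
-- g x and g (flip i x) are g₀ x and g₁ x in some order, so
-- g + g ∘ flip i = g₀ + g₁ (`decision-pair`).  As flip i permutes the cube,
-- this gives (`double-inner`)
--
--   2 L g = L g₀ + L g₁ + ∑ (λ x → (f x - f (flip i x)) * g x),
--
-- where the last sum is at most M because g takes values in [0,1].  A query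
-- thus costs at most M / 2, which leaves room to spare.  The influence is
-- always that of the original f, never that of a restriction of f, so the bound
-- M serves at every node.
--
-- A tree may query a variable twice, and fixing the i-th input must act on the
-- later queries as well.  The induction therefore treats mean T ∘ σ, where σ
-- fixes some coordinates and keeps the others (`Restriction`).

open import Defs
import Algebra.Properties.CommutativeSemigroup as CommutativeSemigroupProperties
import Algebra.Properties.Ring as RingProperties
import Algebra.Properties.Semiring.Mult as MultProperties
open import Data.Bool.Base using (Bool; true; false; not; if_then_else_)
open import Data.Bool.Properties using (not-involutive)
open import Data.Empty using (⊥-elim)
open import Data.Fin.Base using (Fin; zero; suc)
open import Data.Fin.Properties using (_≟_)
open import Data.Nat.Base as ℕ using (ℕ; zero; suc; s≤s; z≤n)
import Data.Nat.Properties as ℕ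
open import Data.Product.Base using (Σ-syntax; ∃-syntax; _,_; proj₁; proj₂)
open import Data.Sum.Base using (_⊎_; inj₁; inj₂)
open import Data.Vec.Base using (Vec; []; _∷_; lookup; truncate; _[_]≔_)
open import Data.Vec.Properties
  using ( updateAt-updateAt-local; updateAt-id; updateAt-cong-local
        ; lookup∘updateAt; lookup∘update; lookup∘update′; []≔-lookup)
open import Function.Base using (_∘_; id)
open import Level using (Level)
open import Relation.Binary.Bundles using (Poset)
open import Relation.Binary.PropositionalEquality as ≡ using (_≡_)
import Relation.Binary.Reasoning.PartialOrder as PartialOrderReasoning
open import Relation.Nullary using (yes; no)

-- Ordered fields

module OrderedFieldProperties {c ℓ₁ ℓ₂ : Level} (F : OrderedField c ℓ₁ ℓ₂) where
  open OrderedField F hiding (zero)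
  open RingProperties ring using (-‿distribˡ-*; -‿distribʳ-*; -‿involutive)
  open MultProperties semiring using (×-assoc-*; ×-homo-+; ×-congʳ)

  poset : Poset c ℓ₁ ℓ₂
  poset = record { isPartialOrder = isPartialOrder }

  open PartialOrderReasoning poset

  x-y+y≈x : ∀ x y → (x - y) + y ≈ x
  x-y+y≈x x y = begin-equality
    (x - y) + y    ≈⟨ +-assoc x (- y) y ⟩
    x + (- y + y)  ≈⟨ +-congˡ (-‿inverseˡ y) ⟩
    x + 0#         ≈⟨ +-identityʳ x ⟩
    x              ∎

  +-monoʳ-≤ : ∀ {x y} z → x ≤ y → z + x ≤ z + y
  +-monoʳ-≤ {x} {y} z x≤y = begin
    z + x  ≈⟨ +-comm z x ⟩
    x + z  ≤⟨ +-monoˡ-≤ z x≤y ⟩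
    y + z  ≈⟨ +-comm y z ⟩
    z + y  ∎

  +-mono-≤ : ∀ {x y u v} → x ≤ y → u ≤ v → x + u ≤ y + v
  +-mono-≤ {y = y} {u} x≤y u≤v = ≤-trans (+-monoˡ-≤ u x≤y) (+-monoʳ-≤ y u≤v)

  x≤y⇒0≤y-x : ∀ {x y} → x ≤ y → 0# ≤ y - x
  x≤y⇒0≤y-x {x} x≤y = ≤-respˡ-≈ (-‿inverseʳ x) (+-monoˡ-≤ (- x) x≤y)

  0≤y-x⇒x≤y : ∀ {x y} → 0# ≤ y - x → x ≤ y
  0≤y-x⇒x≤y {x} {y} 0≤y-x =
    ≤-respˡ-≈ (+-identityˡ x) (≤-respʳ-≈ (x-y+y≈x y x) (+-monoˡ-≤ x 0≤y-x))

  x≤0⇒0≤-x : ∀ {x} → x ≤ 0# → 0# ≤ - x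
  x≤0⇒0≤-x {x} x≤0 = ≤-respʳ-≈ (+-identityˡ (- x)) (x≤y⇒0≤y-x x≤0)

  0≤-x⇒x≤0 : ∀ {x} → 0# ≤ - x → x ≤ 0#
  0≤-x⇒x≤0 {x} 0≤-x = 0≤y-x⇒x≤y (≤-respʳ-≈ (sym (+-identityˡ (- x))) 0≤-x)

  *-monoˡ-≤ : ∀ {x y z} → 0# ≤ z → x ≤ y → z * x ≤ z * y
  *-monoˡ-≤ {x} {y} {z} 0≤z x≤y = 0≤y-x⇒x≤y (begin
    0#               ≤⟨ *-nonNeg 0≤z (x≤y⇒0≤y-x x≤y) ⟩
    z * (y - x)      ≈⟨ distribˡ z y (- x) ⟩
    z * y + z * - x  ≈⟨ +-congˡ (-‿distribʳ-* z x) ⟨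
    z * y - z * x    ∎)

  *-monoʳ-≤ : ∀ {x y z} → 0# ≤ z → x ≤ y → x * z ≤ y * z
  *-monoʳ-≤ {x} {y} {z} 0≤z x≤y = begin
    x * z  ≈⟨ *-comm x z ⟩
    z * x  ≤⟨ *-monoˡ-≤ 0≤z x≤y ⟩
    z * y  ≈⟨ *-comm z y ⟩
    y * z  ∎

  x+x≤y+y⇒x≤y : ∀ {x y} → x + x ≤ y + y → x ≤ y
  x+x≤y+y⇒x≤y {x} {y} 2x≤2y with total x y
  ... | inj₁ x≤y = x≤y
  -- If y ≤ x, then x + x ≤ y + y ≤ x + y, and x cancels.
  ... | inj₂ y≤x = begin
    x                ≈⟨ x+y-x≈y x x ⟨
    (x + x) + - x    ≤⟨ +-monoˡ-≤ (- x) (≤-trans 2x≤2y (+-monoˡ-≤ y y≤x)) ⟩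
    (x + y) + - x    ≈⟨ x+y-x≈y x y ⟩
    y                ∎
    where
    x+y-x≈y : ∀ x y → (x + y) + - x ≈ y
    x+y-x≈y x y = begin-equality
      (x + y) - x    ≈⟨ +-congʳ (+-comm x y) ⟩
      (y + x) - x    ≈⟨ +-assoc y x (- x) ⟩
      y + (x - x)    ≈⟨ +-congˡ (-‿inverseʳ x) ⟩
      y + 0#         ≈⟨ +-identityʳ y ⟩
      y              ∎

  x+x≈y+y⇒x≈y : ∀ {x y} → x + x ≈ y + y → x ≈ y
  x+x≈y+y⇒x≈y 2x≈2y = antisym (x+x≤y+y⇒x≤y (≤-reflexive 2x≈2y))
                              (x+x≤y+y⇒x≤y (≤-reflexive (sym 2x≈2y)))

  0≤1 : 0# ≤ 1#
  0≤1 with total 0# 1#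
  ... | inj₁ 0≤1 = 0≤1
  -- If 1 ≤ 0, then 1 is the product of the nonnegative numbers -1 and -1.
  ... | inj₂ 1≤0 = begin
    0#             ≤⟨ *-nonNeg (x≤0⇒0≤-x 1≤0) (x≤0⇒0≤-x 1≤0) ⟩
    - 1# * - 1#    ≈⟨ -‿distribˡ-* 1# (- 1#) ⟨
    - (1# * - 1#)  ≈⟨ -‿cong (*-identityˡ (- 1#)) ⟩
    - - 1#         ≈⟨ -‿involutive 1# ⟩
    1#             ∎

  1≤x⇒x≉0 : ∀ {x} → 1# ≤ x → x ≉ 0#
  1≤x⇒x≉0 1≤x x≈0 = 1≉0 (antisym (≤-respʳ-≈ x≈0 1≤x) 0≤1)

  0≤fromℕ : ∀ n → 0# ≤ fromℕ n
  0≤fromℕ zero    = ≤-refl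
  0≤fromℕ (suc n) =
    ≤-respˡ-≈ (+-identityʳ 0#) (+-mono-≤ 0≤1 (0≤fromℕ n))

  1≤fromℕ : ∀ n .{{_ : ℕ.NonZero n}} → 1# ≤ fromℕ n
  1≤fromℕ (suc n) = ≤-respˡ-≈ (+-identityʳ 1#) (+-monoʳ-≤ 1# (0≤fromℕ n))

  fromℕ≉0 : ∀ n .{{_ : ℕ.NonZero n}} → fromℕ n ≉ 0#
  fromℕ≉0 n = 1≤x⇒x≉0 (1≤fromℕ n)

  ×-≈-fromℕ-* : ∀ n x → n × x ≈ fromℕ n * x
  ×-≈-fromℕ-* n x = begin-equality
    n × x         ≈⟨ ×-congʳ n (*-identityˡ x) ⟨
    n × (1# * x)  ≈⟨ ×-assoc-* n 1# x ⟨
    fromℕ n * x   ∎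

  0≤× : ∀ n {x} → 0# ≤ x → 0# ≤ n × x
  0≤× n {x} 0≤x = ≤-respʳ-≈ (sym (×-≈-fromℕ-* n x)) (*-nonNeg (0≤fromℕ n) 0≤x)

  ⁻¹-unique : ∀ {x y} → x ≉ 0# → x * y ≈ 1# → y ≈ x ⁻¹
  ⁻¹-unique {x} {y} x≉0 xy≈1 = begin-equality
    y               ≈⟨ *-identityʳ y ⟨
    y * 1#          ≈⟨ *-congˡ (⁻¹-inverseʳ x≉0) ⟨
    y * (x * x ⁻¹)  ≈⟨ *-assoc y x (x ⁻¹) ⟨
    (y * x) * x ⁻¹  ≈⟨ *-congʳ (trans (*-comm y x) xy≈1) ⟩
    1# * x ⁻¹       ≈⟨ *-identityˡ (x ⁻¹) ⟩
    x ⁻¹            ∎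

  0≤x⁻¹ : ∀ {x} → 1# ≤ x → 0# ≤ x ⁻¹
  0≤x⁻¹ {x} 1≤x with total 0# (x ⁻¹)
  ... | inj₁ 0≤x⁻¹ = 0≤x⁻¹
  -- If x⁻¹ ≤ 0, then 1 = x * x⁻¹ ≤ x * 0 = 0.
  ... | inj₂ x⁻¹≤0 = ⊥-elim (1≉0 (antisym 1≤0 0≤1))
    where
    1≤0 : 1# ≤ 0#
    1≤0 = begin
      1#        ≈⟨ ⁻¹-inverseʳ (1≤x⇒x≉0 1≤x) ⟨
      x * x ⁻¹  ≤⟨ *-monoˡ-≤ (≤-trans 0≤1 1≤x) x⁻¹≤0 ⟩
      x * 0#    ≈⟨ zeroʳ x ⟩
      0#        ∎

  *-/-cancel : ∀ {x} y → x ≉ 0# → (x * y) / x ≈ y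
  *-/-cancel {x} y x≉0 = begin-equality
    (x * y) * x ⁻¹  ≈⟨ *-congʳ (*-comm x y) ⟩
    (y * x) * x ⁻¹  ≈⟨ *-assoc y x (x ⁻¹) ⟩
    y * (x * x ⁻¹)  ≈⟨ *-congˡ (⁻¹-inverseʳ x≉0) ⟩
    y * 1#          ≈⟨ *-identityʳ y ⟩
    y               ∎

  /-*-cancel : ∀ {x} y → x ≉ 0# → x * (y / x) ≈ y
  /-*-cancel {x} y x≉0 = trans (sym (*-assoc x y (x ⁻¹))) (*-/-cancel y x≉0)

  fromℕ-2^suc : ∀ k → fromℕ (2 ℕ.^ suc k) ≈ fromℕ (2 ℕ.^ k) + fromℕ (2 ℕ.^ k)
  fromℕ-2^suc k = begin-equality
    fromℕ (2 ℕ.^ k ℕ.+ (2 ℕ.^ k ℕ.+ 0))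
      ≈⟨ ×-homo-+ 1# (2 ℕ.^ k) (2 ℕ.^ k ℕ.+ 0) ⟩
    fromℕ (2 ℕ.^ k) + fromℕ (2 ℕ.^ k ℕ.+ 0)
      ≈⟨ +-congˡ (reflexive (≡.cong fromℕ (ℕ.+-identityʳ (2 ℕ.^ k)))) ⟩
    fromℕ (2 ℕ.^ k) + fromℕ (2 ℕ.^ k) ∎

  -- The two halves of the unit of mass 1 / 2 ^ k.
  half-weight : ∀ k → fromℕ (2 ℕ.^ suc k) ⁻¹ + fromℕ (2 ℕ.^ suc k) ⁻¹
                      ≈ fromℕ (2 ℕ.^ k) ⁻¹
  half-weight k = ⁻¹-unique (fromℕ≉0 (2 ℕ.^ k) {{ℕ.m^n≢0 2 k}}) (begin-equality
    N * (w + w)    ≈⟨ distribˡ N w w ⟩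
    N * w + N * w  ≈⟨ distribʳ w N N ⟨
    (N + N) * w    ≈⟨ *-congʳ (fromℕ-2^suc k) ⟨
    fromℕ (2 ℕ.^ suc k) * w
                   ≈⟨ ⁻¹-inverseʳ (fromℕ≉0 (2 ℕ.^ suc k) {{ℕ.m^n≢0 2 (suc k)}}) ⟩
    1#             ∎)
    where
    N = fromℕ (2 ℕ.^ k)
    w = fromℕ (2 ℕ.^ suc k) ⁻¹

  y*w≤∣y∣ : ∀ y {w} → 0# ≤ w → w ≤ 1# → y * w ≤ ∣ y ∣
  y*w≤∣y∣ y {w} 0≤w w≤1 with total 0# y
  ... | inj₁ 0≤y = ≤-respʳ-≈ (*-identityʳ y) (*-monoˡ-≤ 0≤y w≤1)
  ... | inj₂ y≤0 = ≤-trans (0≤-x⇒x≤0 0≤-yw) (x≤0⇒0≤-x y≤0)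
    where
    0≤-yw : 0# ≤ - (y * w)
    0≤-yw = ≤-respʳ-≈ (sym (-‿distribˡ-* y w)) (*-nonNeg (x≤0⇒0≤-x y≤0) 0≤w)

  0≤∣y∣ : ∀ y → 0# ≤ ∣ y ∣
  0≤∣y∣ y = ≤-respˡ-≈ (zeroʳ y) (y*w≤∣y∣ y ≤-refl 0≤1)

  argmax : ∀ {n} (φ : Fin (suc n) → Carrier) → ∃[ i ] (∀ j → φ j ≤ φ i)
  argmax {zero}  φ = zero , λ { zero → ≤-refl }
  argmax {suc n} φ with argmax (φ ∘ suc)
  ... | i , max with total (φ zero) (φ (suc i))
  ...   | inj₁ φ₀≤ = suc i , λ { zero → φ₀≤ ; (suc j) → max j }
  ...   | inj₂ ≤φ₀ = zero , λ { zero → ≤-refl ; (suc j) → ≤-trans (max j) ≤φ₀ }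

-- Sums and averages over the cube

module DecisionTreeProperties {c ℓ₁ ℓ₂ : Level} (F : OrderedField c ℓ₁ ℓ₂) where
  open OrderedField F hiding (zero)
  open OrderedFieldProperties F
  open DecisionTree F
  open CommutativeSemigroupProperties +-commutativeSemigroup using (interchange)
  open PartialOrderReasoning poset

  ∑-cong : ∀ {k} {f g : Vec Bool k → Carrier} → (∀ x → f x ≈ g x) → ∑ f ≈ ∑ g
  ∑-cong {zero}  f≈g = f≈g []
  ∑-cong {suc k} f≈g =
    +-cong (∑-cong (f≈g ∘ (false ∷_))) (∑-cong (f≈g ∘ (true ∷_)))

  ∑-mono : ∀ {k} {f g : Vec Bool k → Carrier} → (∀ x → f x ≤ g x) → ∑ f ≤ ∑ g
  ∑-mono {zero}  f≤g = f≤g []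
  ∑-mono {suc k} f≤g =
    +-mono-≤ (∑-mono (f≤g ∘ (false ∷_))) (∑-mono (f≤g ∘ (true ∷_)))

  ∑-+ : ∀ {k} (f g : Vec Bool k → Carrier) → ∑ (λ x → f x + g x) ≈ ∑ f + ∑ g
  ∑-+ {zero}  f g = refl
  ∑-+ {suc k} f g = trans
    (+-cong (∑-+ (f ∘ (false ∷_)) (g ∘ (false ∷_)))
            (∑-+ (f ∘ (true ∷_)) (g ∘ (true ∷_))))
    (interchange _ _ _ _)

  ∑-*ʳ : ∀ {k} (f : Vec Bool k → Carrier) c → ∑ (λ x → f x * c) ≈ ∑ f * c
  ∑-*ʳ {zero}  f c = refl
  ∑-*ʳ {suc k} f c = trans
    (+-cong (∑-*ʳ (f ∘ (false ∷_)) c) (∑-*ʳ (f ∘ (true ∷_)) c))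
    (sym (distribʳ c _ _))

  ∑-flip : ∀ {k} (i : Fin k) (f : Vec Bool k → Carrier) → ∑ (f ∘ flip i) ≈ ∑ f
  ∑-flip zero    f = +-comm _ _
  ∑-flip (suc i) f =
    +-cong (∑-flip i (f ∘ (false ∷_))) (∑-flip i (f ∘ (true ∷_)))

  1≤2^ : ∀ k → 1# ≤ fromℕ (2 ℕ.^ k)
  1≤2^ k = 1≤fromℕ (2 ℕ.^ k) {{ℕ.m^n≢0 2 k}}

  𝔼-mono : ∀ {k} {f g : Vec Bool k → Carrier} → (∀ x → f x ≤ g x) → 𝔼 f ≤ 𝔼 g
  𝔼-mono {k} f≤g = *-monoʳ-≤ (0≤x⁻¹ (1≤2^ k)) (∑-mono f≤g)

  -- The mean is the average of the means over the two halves of the cube.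
  𝔼-split : ∀ {k} (f : Vec Bool (suc k) → Carrier) →
            𝔼 f + 𝔼 f ≈ 𝔼 (f ∘ (false ∷_)) + 𝔼 (f ∘ (true ∷_))
  𝔼-split {k} f = begin-equality
    ∑ f * w + ∑ f * w  ≈⟨ distribˡ (∑ f) w w ⟨
    ∑ f * (w + w)      ≈⟨ *-congˡ (half-weight k) ⟩
    ∑ f * fromℕ (2 ℕ.^ k) ⁻¹
                       ≈⟨ distribʳ _ _ _ ⟩
    𝔼 (f ∘ (false ∷_)) + 𝔼 (f ∘ (true ∷_)) ∎
    where w = fromℕ (2 ℕ.^ suc k) ⁻¹

  ∑-const : ∀ k v → ∑ {k} (λ _ → v) ≈ fromℕ (2 ℕ.^ k) * v
  ∑-const k v = begin-equality
    ∑ {k} (λ _ → v)        ≈⟨ ∑-cong {k} (λ _ → *-identityˡ v) ⟨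
    ∑ {k} (λ _ → 1# * v)   ≈⟨ ∑-*ʳ {k} (λ _ → 1#) v ⟩
    ∑ {k} (λ _ → 1#) * v   ≈⟨ *-congʳ (∑-1 k) ⟩
    fromℕ (2 ℕ.^ k) * v    ∎
    where
    ∑-1 : ∀ k → ∑ {k} (λ _ → 1#) ≈ fromℕ (2 ℕ.^ k)
    ∑-1 zero    = sym (+-identityʳ 1#)
    ∑-1 (suc k) = trans (+-cong (∑-1 k) (∑-1 k)) (sym (fromℕ-2^suc k))

  𝔼-const : ∀ k v → 𝔼 {k} (λ _ → v) ≈ v
  𝔼-const k v = begin-equality
    𝔼 {k} (λ _ → v)            ≈⟨ *-congʳ (∑-const k v) ⟩
    (fromℕ (2 ℕ.^ k) * v) / fromℕ (2 ℕ.^ k)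
                               ≈⟨ *-/-cancel v (1≤x⇒x≉0 (1≤2^ k)) ⟩
    v                          ∎

  ∑-centred : ∀ {k} (f : Vec Bool k → Carrier) → ∑ (λ x → f x - 𝔼 f) ≈ 0#
  ∑-centred {k} f = begin-equality
    S                      ≈⟨ +-identityʳ S ⟨
    S + 0#                 ≈⟨ +-congˡ (-‿inverseʳ (∑ f)) ⟨
    S + (∑ f - ∑ f)        ≈⟨ +-assoc S (∑ f) (- ∑ f) ⟨
    (S + ∑ f) - ∑ f        ≈⟨ +-congʳ S+∑f≈∑f ⟩
    ∑ f - ∑ f              ≈⟨ -‿inverseʳ (∑ f) ⟩
    0#                     ∎
    where
    S = ∑ (λ x → f x - 𝔼 f)
    S+∑f≈∑f : S + ∑ f ≈ ∑ f
    S+∑f≈∑f = begin-equality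
      S + ∑ f                        ≈⟨ +-congˡ (/-*-cancel (∑ f) (1≤x⇒x≉0 (1≤2^ k))) ⟨
      S + fromℕ (2 ℕ.^ k) * 𝔼 f      ≈⟨ +-congˡ (∑-const k (𝔼 f)) ⟨
      S + ∑ {k} (λ _ → 𝔼 f)          ≈⟨ ∑-+ (λ x → f x - 𝔼 f) (λ _ → 𝔼 f) ⟨
      ∑ (λ x → (f x - 𝔼 f) + 𝔼 f)    ≈⟨ ∑-cong (λ x → x-y+y≈x (f x) (𝔼 f)) ⟩
      ∑ f                            ∎

  -- Unused random bits do not change a mean.
  𝔼-truncate : ∀ {m k} (m≤k : m ℕ.≤ k) (f : Vec Bool m → Carrier) →
               𝔼 (f ∘ truncate m≤k) ≈ 𝔼 f
  𝔼-truncate {k = k} z≤n f =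
    trans (𝔼-const k (f [])) (sym (𝔼-const 0 (f [])))
  𝔼-truncate (s≤s m≤k) f = x+x≈y+y⇒x≈y (begin-equality
    𝔼 (f ∘ truncate (s≤s m≤k)) + 𝔼 (f ∘ truncate (s≤s m≤k))
      ≈⟨ 𝔼-split (f ∘ truncate (s≤s m≤k)) ⟩
    𝔼 ((f ∘ (false ∷_)) ∘ truncate m≤k) + 𝔼 ((f ∘ (true ∷_)) ∘ truncate m≤k)
      ≈⟨ +-cong (𝔼-truncate m≤k (f ∘ (false ∷_)))
                (𝔼-truncate m≤k (f ∘ (true ∷_))) ⟩
    𝔼 (f ∘ (false ∷_)) + 𝔼 (f ∘ (true ∷_))
      ≈⟨ 𝔼-split f ⟨
    𝔼 f + 𝔼 f ∎)

-- Mean functions of decision trees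

  mean-leaf : ∀ {n} v (x : Vec Bool n) → mean (leaf v) x ≈ value v
  mean-leaf v x = 𝔼-const 0 (value v)

  mean-coin : ∀ {n} (t₀ t₁ : Tree n) x →
              mean (coin t₀ t₁) x + mean (coin t₀ t₁) x ≈ mean t₀ x + mean t₁ x
  mean-coin t₀ t₁ x = trans
    (𝔼-split (λ r → value (run (coin t₀ t₁) x r)))
    (+-cong
      (𝔼-truncate (ℕ.m≤m⊔n (randomness t₀) _) (λ r → value (run t₀ x r)))
      (𝔼-truncate (ℕ.m≤n⊔m (randomness t₀) _) (λ r → value (run t₁ x r))))

  mean-decision : ∀ {n} i (t₀ t₁ : Tree n) x {b} → lookup x i ≡ b →
                  mean (decision i t₀ t₁) x ≈ mean (if b then t₁ else t₀) x
  mean-decision i t₀ t₁ x {false} xᵢ≡b rewrite xᵢ≡b =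
    𝔼-truncate (ℕ.m≤m⊔n (randomness t₀) _) (λ r → value (run t₀ x r))
  mean-decision i t₀ t₁ x {true} xᵢ≡b rewrite xᵢ≡b =
    𝔼-truncate (ℕ.m≤n⊔m (randomness t₀) _) (λ r → value (run t₁ x r))

  0≤mean : ∀ {n} (R : Tree n) x → 0# ≤ mean R x
  0≤mean R x = ≤-respˡ-≈ (𝔼-const (randomness R) 0#)
                         (𝔼-mono (λ r → UnitInterval.0≤ (run R x r)))

  mean≤1 : ∀ {n} (R : Tree n) x → mean R x ≤ 1#
  mean≤1 R x = ≤-respʳ-≈ (𝔼-const (randomness R) 1#)
                         (𝔼-mono (λ r → UnitInterval.≤1 (run R x r)))

  flip-involutive : ∀ {n} (i : Fin n) x → flip i (flip i x) ≡ x
  flip-involutive i x = ≡.trans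
    (updateAt-updateAt-local i x (not-involutive (lookup x i)))
    (updateAt-id i x)

  -- σ acts on each coordinate separately: it either keeps the coordinate or
  -- sets it to a constant bit.
  Restriction : ∀ {n} → (Vec Bool n → Vec Bool n) → Set
  Restriction σ = ∀ i → (∀ x → lookup (σ x) i ≡ lookup x i)
                      ⊎ (∃[ b ] (∀ x → lookup (σ x) i ≡ b))

  id-restriction : ∀ {n} → Restriction {n} id
  id-restriction i = inj₁ λ _ → ≡.refl

  -- Fixing the i-th input has no effect on a coordinate that σ already fixes.
  restrict : ∀ {n} (σ : Vec Bool n → Vec Bool n) → Restriction σ →
             ∀ i b → Restriction (λ x → σ (x [ i ]≔ b))
  restrict σ ρ i b j with ρ j
  ... | inj₂ (b′ , fixed) = inj₂ (b′ , λ x → fixed (x [ i ]≔ b))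
  ... | inj₁ kept with j ≟ i
  ...   | yes ≡.refl = inj₂ (b , λ x →
            ≡.trans (kept (x [ j ]≔ b)) (lookup∘update j x b))
  ...   | no j≢i     = inj₁ λ x →
            ≡.trans (kept (x [ i ]≔ b)) (lookup∘update′ j≢i x b)

  -- The points x and flip i x take different branches at a node querying i.
  decision-pair : ∀ {n} i (t₀ t₁ : Tree n) (σ : Vec Bool n → Vec Bool n) →
    (∀ x → lookup (σ x) i ≡ lookup x i) → ∀ x →
    mean (decision i t₀ t₁) (σ x) + mean (decision i t₀ t₁) (σ (flip i x)) ≈
    mean t₀ (σ (x [ i ]≔ false)) + mean t₁ (σ (x [ i ]≔ true))
  decision-pair i t₀ t₁ σ kept x = pair (lookup x i) ≡.refl
    where
    g = mean (decision i t₀ t₁) ∘ σ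

    value-at : ∀ {y} b → lookup y i ≡ b → y ≡ x [ i ]≔ b →
               g y ≈ mean (if b then t₁ else t₀) (σ (x [ i ]≔ b))
    value-at {y} b yᵢ≡b y≡ = trans
      (mean-decision i t₀ t₁ (σ y) (≡.trans (kept y) yᵢ≡b))
      (reflexive (≡.cong (mean (if b then t₁ else t₀) ∘ σ) y≡))

    at-x : ∀ b → lookup x i ≡ b →
           g x ≈ mean (if b then t₁ else t₀) (σ (x [ i ]≔ b))
    at-x b xᵢ≡b = value-at b xᵢ≡b
      (≡.trans (≡.sym ([]≔-lookup x i)) (≡.cong (x [ i ]≔_) xᵢ≡b))

    at-flip : ∀ b → lookup x i ≡ b →
              g (flip i x) ≈ mean (if not b then t₁ else t₀) (σ (x [ i ]≔ not b))
    at-flip b xᵢ≡b = value-at (not b)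
      (≡.trans (lookup∘updateAt i x) (≡.cong not xᵢ≡b))
      (updateAt-cong-local i x (≡.cong not xᵢ≡b))

    pair : ∀ b → lookup x i ≡ b → g x + g (flip i x) ≈
           mean t₀ (σ (x [ i ]≔ false)) + mean t₁ (σ (x [ i ]≔ true))
    pair false xᵢ≡b = +-cong (at-x false xᵢ≡b) (at-flip false xᵢ≡b)
    pair true  xᵢ≡b =
      trans (+-comm _ _) (+-cong (at-flip true xᵢ≡b) (at-x true xᵢ≡b))

-- The covariance bound

  -- The unnormalised inner product on functions on the cube.
  ⟪_,_⟫ : ∀ {k} → (Vec Bool k → Carrier) → (Vec Bool k → Carrier) → Carrier
  ⟪ f , g ⟫ = ∑ (λ x → f x * g x)

  -- The influence Inf i f multiplied by 2 ^ k.
  totalInf : ∀ {k} → (Vec Bool k → Carrier) → Fin k → Carrier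
  totalInf f i = ∑ (λ x → ∣ f x - f (flip i x) ∣)

  inner-congʳ : ∀ {k} (f : Vec Bool k → Carrier) {g h : Vec Bool k → Carrier} →
                (∀ x → g x ≈ h x) → ⟪ f , g ⟫ ≈ ⟪ f , h ⟫
  inner-congʳ f g≈h = ∑-cong (λ x → *-congˡ (g≈h x))

  inner-+ʳ : ∀ {k} (f g h : Vec Bool k → Carrier) →
             ⟪ f , (λ x → g x + h x) ⟫ ≈ ⟪ f , g ⟫ + ⟪ f , h ⟫
  inner-+ʳ f g h =
    trans (∑-cong (λ x → distribˡ (f x) (g x) (h x)))
          (∑-+ (λ x → f x * g x) (λ x → f x * h x))

  0≤totalInf : ∀ {k} (f : Vec Bool k → Carrier) i → 0# ≤ totalInf f i
  0≤totalInf {k} f i = begin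
    0#                    ≈⟨ zeroʳ _ ⟨
    fromℕ (2 ℕ.^ k) * 0#  ≈⟨ ∑-const k 0# ⟨
    ∑ {k} (λ _ → 0#)      ≤⟨ ∑-mono {k} (λ x → 0≤∣y∣ (f x - f (flip i x))) ⟩
    totalInf f i          ∎

  -- The effect of symmetrising g in coordinate i, where u is the increment of h
  -- in that coordinate.  It holds because flip i is self-adjoint:
  -- ⟪ h ∘ flip i , g ⟫ = ⟪ h , g ∘ flip i ⟫.
  double-inner : ∀ {k} i (h u g : Vec Bool k → Carrier) →
    (∀ x → h x ≈ h (flip i x) + u x) →
    ⟪ h , g ⟫ + ⟪ h , g ⟫ ≈ ⟪ h , (λ x → g x + g (flip i x)) ⟫ + ⟪ u , g ⟫
  double-inner i h u g h≈ = begin-equality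
    ⟪ h , g ⟫ + ⟪ h , g ⟫
      ≈⟨ +-congˡ split ⟩
    ⟪ h , g ⟫ + (⟪ h ∘ flip i , g ⟫ + ⟪ u , g ⟫)
      ≈⟨ +-assoc _ _ _ ⟨
    (⟪ h , g ⟫ + ⟪ h ∘ flip i , g ⟫) + ⟪ u , g ⟫
      ≈⟨ +-congʳ (+-congˡ adjoint) ⟩
    (⟪ h , g ⟫ + ⟪ h , g ∘ flip i ⟫) + ⟪ u , g ⟫
      ≈⟨ +-congʳ (inner-+ʳ h g (g ∘ flip i)) ⟨
    ⟪ h , (λ x → g x + g (flip i x)) ⟫ + ⟪ u , g ⟫ ∎
    where
    split : ⟪ h , g ⟫ ≈ ⟪ h ∘ flip i , g ⟫ + ⟪ u , g ⟫
    split = trans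
      (∑-cong (λ x → trans (*-congʳ (h≈ x)) (distribʳ (g x) (h (flip i x)) (u x))))
      (∑-+ (λ x → h (flip i x) * g x) (λ x → u x * g x))

    adjoint : ⟪ h ∘ flip i , g ⟫ ≈ ⟪ h , g ∘ flip i ⟫
    adjoint = begin-equality
      ⟪ h ∘ flip i , g ⟫
        ≈⟨ ∑-flip i (λ x → h (flip i x) * g x) ⟨
      ∑ (λ x → h (flip i (flip i x)) * g (flip i x))
        ≈⟨ ∑-cong (λ x → *-congʳ (reflexive (≡.cong h (flip-involutive i x)))) ⟩
      ⟪ h , g ∘ flip i ⟫ ∎

  module _ {n} (f : Vec Bool n → Carrier) (M : Carrier)
           (0≤M : 0# ≤ M) (totalInf≤M : ∀ i → totalInf f i ≤ M) where

    private
      -- f centred at its mean.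
      f̃ : Vec Bool n → Carrier
      f̃ x = f x - 𝔼 f

      -- f̃ and f have the same increments.
      f̃-increment : ∀ i x → f̃ x ≈ f̃ (flip i x) + (f x - f (flip i x))
      f̃-increment i x = begin-equality
        a - e              ≈⟨ +-congʳ (x-y+y≈x a b) ⟨
        ((a - b) + b) - e  ≈⟨ +-assoc _ _ _ ⟩
        (a - b) + (b - e)  ≈⟨ +-comm _ _ ⟩
        (b - e) + (a - b)  ∎
        where
        a = f x
        b = f (flip i x)
        e = 𝔼 f

    -- The left-hand side is 2 ^ n times the covariance of f and mean T ∘ σ.  The
    -- function f and the bound M stay the same throughout the induction on T.
    covariance-bound : ∀ (T : Tree n) d → queryComplexity T ℕ.≤ d →
      ∀ (σ : Vec Bool n → Vec Bool n) → Restriction σ →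
      ⟪ f̃ , mean T ∘ σ ⟫ ≤ d × M
    covariance-bound (leaf v) d _ σ ρ = begin
      ⟪ f̃ , mean (leaf v) ∘ σ ⟫  ≈⟨ inner-congʳ f̃ (λ x → mean-leaf v (σ x)) ⟩
      ⟪ f̃ , (λ _ → value v) ⟫    ≈⟨ ∑-*ʳ f̃ (value v) ⟩
      ∑ f̃ * value v              ≈⟨ *-congʳ (∑-centred f) ⟩
      0# * value v               ≈⟨ zeroˡ (value v) ⟩
      0#                         ≤⟨ 0≤× d 0≤M ⟩
      d × M                      ∎
    covariance-bound (coin t₀ t₁) d qc≤d σ ρ = x+x≤y+y⇒x≤y (begin
      ⟪ f̃ , g ⟫ + ⟪ f̃ , g ⟫
        ≈⟨ inner-+ʳ f̃ g g ⟨
      ⟪ f̃ , (λ x → g x + g x) ⟫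
        ≈⟨ inner-congʳ f̃ (λ x → mean-coin t₀ t₁ (σ x)) ⟩
      ⟪ f̃ , (λ x → mean t₀ (σ x) + mean t₁ (σ x)) ⟫
        ≈⟨ inner-+ʳ f̃ (mean t₀ ∘ σ) (mean t₁ ∘ σ) ⟩
      ⟪ f̃ , mean t₀ ∘ σ ⟫ + ⟪ f̃ , mean t₁ ∘ σ ⟫
        ≤⟨ +-mono-≤
             (covariance-bound t₀ d (ℕ.m⊔n≤o⇒m≤o (queryComplexity t₀) _ qc≤d) σ ρ)
             (covariance-bound t₁ d (ℕ.m⊔n≤o⇒n≤o (queryComplexity t₀) _ qc≤d) σ ρ) ⟩
      d × M + d × M ∎)
      where g = mean (coin t₀ t₁) ∘ σ
    covariance-bound (decision i t₀ t₁) (suc d) (s≤s qc≤d) σ ρ with ρ i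
    -- σ fixes the i-th coordinate, so the outcome of the query is determined.
    ... | inj₂ (b , fixed) = begin
      ⟪ f̃ , mean (decision i t₀ t₁) ∘ σ ⟫
        ≈⟨ inner-congʳ f̃ (λ x → mean-decision i t₀ t₁ (σ x) (fixed x)) ⟩
      ⟪ f̃ , mean (if b then t₁ else t₀) ∘ σ ⟫
        ≤⟨ branch b ⟩
      d × M
        ≈⟨ +-identityˡ (d × M) ⟨
      0# + d × M
        ≤⟨ +-monoˡ-≤ (d × M) 0≤M ⟩
      suc d × M ∎
      where
      branch : ∀ b → ⟪ f̃ , mean (if b then t₁ else t₀) ∘ σ ⟫ ≤ d × M
      branch false =
        covariance-bound t₀ d (ℕ.m⊔n≤o⇒m≤o (queryComplexity t₀) _ qc≤d) σ ρ
      branch true  =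
        covariance-bound t₁ d (ℕ.m⊔n≤o⇒n≤o (queryComplexity t₀) _ qc≤d) σ ρ
    ... | inj₁ kept = x+x≤y+y⇒x≤y (begin
      ⟪ f̃ , g ⟫ + ⟪ f̃ , g ⟫
        ≈⟨ double-inner i f̃ u g (f̃-increment i) ⟩
      ⟪ f̃ , (λ x → g x + g (flip i x)) ⟫ + ⟪ u , g ⟫
        ≈⟨ +-congʳ (inner-congʳ f̃ (decision-pair i t₀ t₁ σ kept)) ⟩
      ⟪ f̃ , (λ x → g₀ x + g₁ x) ⟫ + ⟪ u , g ⟫
        ≈⟨ +-congʳ (inner-+ʳ f̃ g₀ g₁) ⟩
      (⟪ f̃ , g₀ ⟫ + ⟪ f̃ , g₁ ⟫) + ⟪ u , g ⟫
        ≤⟨ +-mono-≤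
             (+-mono-≤
               (covariance-bound t₀ d (ℕ.m⊔n≤o⇒m≤o (queryComplexity t₀) _ qc≤d)
                 (λ x → σ (x [ i ]≔ false)) (restrict σ ρ i false))
               (covariance-bound t₁ d (ℕ.m⊔n≤o⇒n≤o (queryComplexity t₀) _ qc≤d)
                 (λ x → σ (x [ i ]≔ true)) (restrict σ ρ i true)))
             ⟪u,g⟫≤M ⟩
      (d × M + d × M) + M
        ≈⟨ +-comm _ _ ⟩
      M + (d × M + d × M)
        ≈⟨ +-assoc _ _ _ ⟨
      suc d × M + d × M
        ≤⟨ +-monoʳ-≤ (suc d × M)
             (≤-respˡ-≈ (+-identityˡ (d × M)) (+-monoˡ-≤ (d × M) 0≤M)) ⟩
      suc d × M + suc d × M ∎)
      where
      g g₀ g₁ u : Vec Bool n → Carrier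
      g    = mean (decision i t₀ t₁) ∘ σ
      g₀ x = mean t₀ (σ (x [ i ]≔ false))
      g₁ x = mean t₁ (σ (x [ i ]≔ true))
      u x  = f x - f (flip i x)

      ⟪u,g⟫≤M : ⟪ u , g ⟫ ≤ M
      ⟪u,g⟫≤M = ≤-trans
        (∑-mono (λ x → y*w≤∣y∣ (u x) (0≤mean (decision i t₀ t₁) (σ x))
                                     (mean≤1 (decision i t₀ t₁) (σ x))))
        (totalInf≤M i)

  -- The variance is a covariance: f may replace one of the centred factors.
  ∑-square-centred : ∀ {k} (f : Vec Bool k → Carrier) →
    ∑ (λ x → (f x - 𝔼 f) ^ 2) ≈ ⟪ (λ x → f x - 𝔼 f) , f ⟫
  ∑-square-centred f = begin-equality
    ∑ (λ x → f̃ x ^ 2)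
      ≈⟨ ∑-cong (λ x → *-congˡ (*-identityʳ (f̃ x))) ⟩
    ⟪ f̃ , f̃ ⟫
      ≈⟨ +-identityʳ _ ⟨
    ⟪ f̃ , f̃ ⟫ + 0#
      ≈⟨ +-congˡ (zeroˡ (𝔼 f)) ⟨
    ⟪ f̃ , f̃ ⟫ + 0# * 𝔼 f
      ≈⟨ +-congˡ (*-congʳ (∑-centred f)) ⟨
    ⟪ f̃ , f̃ ⟫ + ∑ f̃ * 𝔼 f
      ≈⟨ +-congˡ (∑-*ʳ f̃ (𝔼 f)) ⟨
    ⟪ f̃ , f̃ ⟫ + ⟪ f̃ , (λ _ → 𝔼 f) ⟫
      ≈⟨ inner-+ʳ f̃ f̃ (λ _ → 𝔼 f) ⟨
    ⟪ f̃ , (λ x → f̃ x + 𝔼 f) ⟫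
      ≈⟨ inner-congʳ f̃ (λ x → x-y+y≈x (f x) (𝔼 f)) ⟩
    ⟪ f̃ , f ⟫ ∎
    where
    f̃ = λ x → f x - 𝔼 f

  influential-variable : ∀ n q → 1 ℕ.≤ n → 1 ℕ.≤ q →
    (R : Tree n) → queryComplexity R ℕ.≤ q →
    Σ[ i ∈ Fin n ] Var (mean R) / fromℕ q ≤ Inf i (mean R)
  influential-variable (suc n) q@(suc _) _ _ R qc≤q = i , (begin
    (V * w) * p               ≤⟨ *-monoʳ-≤ (0≤x⁻¹ (1≤fromℕ q))
                                   (*-monoʳ-≤ (0≤x⁻¹ (1≤2^ (suc n))) V≤qM) ⟩
    ((fromℕ q * M) * w) * p   ≈⟨ *-congʳ (*-assoc (fromℕ q) M w) ⟩
    (fromℕ q * (M * w)) * p   ≈⟨ *-/-cancel (M * w) (fromℕ≉0 q) ⟩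
    M * w                     ∎)
    where
    μ   = mean R
    max = argmax (totalInf μ)
    i   = proj₁ max
    M   = totalInf μ i
    V   = ∑ (λ x → (μ x - 𝔼 μ) ^ 2)
    w   = fromℕ (2 ℕ.^ suc n) ⁻¹
    p   = fromℕ q ⁻¹

    V≤qM : V ≤ fromℕ q * M
    V≤qM = begin
      V                          ≈⟨ ∑-square-centred μ ⟩
      ⟪ (λ x → μ x - 𝔼 μ) , μ ⟫  ≤⟨ covariance-bound μ M (0≤totalInf μ i) (proj₂ max)
                                      R q qc≤q id id-restriction ⟩
      q × M                      ≈⟨ ×-≈-fromℕ-* q M ⟩
      fromℕ q * M                ∎

lemma2p1 : ∀ {c ℓ₁ ℓ₂ : Level} (F : OrderedField c ℓ₁ ℓ₂) →
    let open OrderedField F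
        open DecisionTree F in
    (n q : ℕ) → 1 ℕ.≤ n → 1 ℕ.≤ q →
    (R : Tree n) → queryComplexity R ℕ.≤ q →
    Σ[ i ∈ Fin n ] Var (mean R) / fromℕ q ≤ Inf i (mean R)
lemma2p1 F = DecisionTreeProperties.influential-variable F
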